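{- For all $k,v\in\mathbb{N}$ such that $k\le 2v$, $$f_{2v,k}=\sum_{j\ge0}\sum_{r\ge0}\binom{j}{r}\binom{v-j}{r}\binom{v-(j+r)}{k-(2j+r)}=\sum_{j\ge0}\frac{(k-2j+1)_j\,(v+j-k+1)_{k-2j}}{j!\,(k-2j)!},$$ where $f_{2v,k}$ is the number of order ideals of cardinality $k$ of the fence poset $\mathcal{Z}_{2v}$, and in the last sum a summand with $k-2j<0$ is read as $0$.
   Context: $\mathbb{N}$ contains $0$. The fence poset $\mathcal{Z}_n$ of order $n$ is the poset on $\{z_1,\dots,z_n\}$ whose cover relations are exactly $z_{2j-1}\triangleleft z_{2j}\triangleright z_{2j+1}$ for all $j\ge1$ (whenever the indices lie in $\{1,\dots,n\}$), so odd-indexed elements are minimal; $\mathcal{Z}_0$ is empty. An order ideal of a poset $P$ is a subset $I\subseteq P$ such that $y\in I$ and $z\le y$ imply $z\in I$. $f_{n,k}$ denotes the number of order ideals of $\mathcal{Z}_n$ with exactly $k$ elements (the $k$-th Whitney number of the distributive lattice of order ideals of $\mathcal{Z}_n$, whose rank function is cardinality). Rising factorial: $(a)_0=1$ and $(a)_m=\prod_{i=0}^{m-1}(a+i)$ for integers $m\ge1$. Conventions: $\binom{a}{b}=0$ unless $0\le b\le a$; $1/(m!)=0$ for negative integers $m$, so in the last sum a summand with $k-2j<0$ is $0$ and that sum effectively runs over $0\le j\le k/2$. -}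

module Defs where

open import Level using (0ℓ; _⊔_)
open import Algebra.Bundles.Raw using (RawMonoid)
import Algebra.Definitions.RawMonoid as RawMonoidDefs
open import Data.Bool.Base using (if_then_else_)
open import Data.Empty using (⊥-elim)
open import Data.Fin.Base using (Fin; toℕ)
import Data.Fin.Properties as Fin
open import Data.Fin.Subset using (Subset; inside; outside; _∈_; ∣_∣)
open import Data.Fin.Subset.Properties using (_∈?_)
open import Data.Integer.Base as ℤ using (ℤ; +_; -[1+_])
open import Data.List.Base using (List; []; _∷_; [_]; map; _++_; filter; length)
open import Data.Nat.Base using (ℕ; zero; suc; _+_; _*_; _∸_; _≤_; _!)
open import Data.Nat.Combinatorics using (_C_)
open import Data.Nat.Divisibility using (_∣_; _∣?_; ∣m+n∣m⇒∣n; ∣1⇒≡1)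
open import Data.Nat.Properties using (_≟_; _≤?_; _!*_!≢0; +-comm)
open import Data.Product.Base using (_×_; _,_; ∃)
open import Data.Rational.Base as ℚ using (ℚ; 0ℚ)
open import Data.Sum.Base using (_⊎_; inj₁; inj₂)
import Data.Vec.Base as Vec
open import Relation.Binary.Bundles using (Poset)
open import Relation.Binary.Construct.Closure.ReflexiveTransitive
  using (Star; ε; _◅_)
import Relation.Binary.Construct.Closure.ReflexiveTransitive.Properties as Star
open import Relation.Binary.PropositionalEquality
  using (_≡_; refl; sym; subst)
open import Relation.Nullary.Decidable
  using (Dec; yes; no; does; map′; _×-dec_; _⊎-dec_; _→-dec_)
open import Relation.Nullary.Negation using (¬_)
open import Relation.Unary using (Pred)

-- The element i : Fin n stands for z_{suc (toℕ i)}.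
label : ∀ {n} → Fin n → ℕ
label i = suc (toℕ i)

-- a ⋖ b says that b = z_{2j} and a is z_{2j-1} or z_{2j+1}.
infix 4 _⋖_ _⊑_
_⋖_ : ∀ {n} → Fin n → Fin n → Set
a ⋖ b = 2 ∣ label b × (suc (label a) ≡ label b ⊎ label a ≡ suc (label b))

_⊑_ : ∀ {n} → Fin n → Fin n → Set
_⊑_ = Star _⋖_

private
  ¬2∣both : ∀ {m} → 2 ∣ m → ¬ (2 ∣ suc m)
  ¬2∣both {m} 2∣m 2∣1+m
    with () ← ∣1⇒≡1 (∣m+n∣m⇒∣n (subst (2 ∣_) (+-comm 1 m) 2∣1+m) 2∣m)

  ⋖-no-chain : ∀ {n} {a b c : Fin n} → a ⋖ b → ¬ (b ⋖ c)
  ⋖-no-chain (2∣b , _) (2∣c , inj₁ eq) = ¬2∣both 2∣b (subst (2 ∣_) (sym eq) 2∣c)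
  ⋖-no-chain (2∣b , _) (2∣c , inj₂ eq) = ¬2∣both 2∣c (subst (2 ∣_) eq 2∣b)

⊑⇒≡⊎⋖ : ∀ {n} {a b : Fin n} → a ⊑ b → a ≡ b ⊎ a ⋖ b
⊑⇒≡⊎⋖ ε                 = inj₁ refl
⊑⇒≡⊎⋖ (a⋖b ◅ ε)         = inj₂ a⋖b
⊑⇒≡⊎⋖ (a⋖b ◅ b⋖c ◅ _)   = ⊥-elim (⋖-no-chain a⋖b b⋖c)

≡⊎⋖⇒⊑ : ∀ {n} {a b : Fin n} → a ≡ b ⊎ a ⋖ b → a ⊑ b
≡⊎⋖⇒⊑ (inj₁ refl) = ε
≡⊎⋖⇒⊑ (inj₂ a⋖b)  = a⋖b ◅ ε

⊑-antisym : ∀ {n} {a b : Fin n} → a ⊑ b → b ⊑ a → a ≡ b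
⊑-antisym a⊑b b⊑a with ⊑⇒≡⊎⋖ a⊑b | ⊑⇒≡⊎⋖ b⊑a
... | inj₁ a≡b | _        = a≡b
... | inj₂ _   | inj₁ b≡a = sym b≡a
... | inj₂ a⋖b | inj₂ b⋖a = ⊥-elim (⋖-no-chain a⋖b b⋖a)

fence : ℕ → Poset 0ℓ 0ℓ 0ℓ
fence n = record
  { Carrier        = Fin n
  ; _≈_            = _≡_
  ; _≤_            = _⊑_
  ; isPartialOrder = record
    { isPreorder = Star.isPreorder _⋖_
    ; antisym    = ⊑-antisym
    }
  }

IsOrderIdeal : ∀ {c ℓ₁ ℓ₂ ℓ} (P : Poset c ℓ₁ ℓ₂) →
               Pred (Poset.Carrier P) ℓ → Set (c ⊔ ℓ₂ ⊔ ℓ)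
IsOrderIdeal P I = ∀ y z → I y → z ≤ₚ y → I z
  where open Poset P using () renaming (_≤_ to _≤ₚ_)

_⋖?_ : ∀ {n} (a b : Fin n) → Dec (a ⋖ b)
a ⋖? b = (2 ∣? label b) ×-dec
  ((suc (label a) ≟ label b) ⊎-dec (label a ≟ suc (label b)))

_⊑?_ : ∀ {n} (a b : Fin n) → Dec (a ⊑ b)
a ⊑? b = map′ ≡⊎⋖⇒⊑ ⊑⇒≡⊎⋖ ((a Fin.≟ b) ⊎-dec (a ⋖? b))

isOrderIdeal? : ∀ {n} (I : Subset n) → Dec (IsOrderIdeal (fence n) (_∈ I))
isOrderIdeal? I = Fin.all? λ y → Fin.all? λ z →
  (y ∈? I) →-dec ((z ⊑? y) →-dec (z ∈? I))

-- Every subset of Fin n, each listed exactly once.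
subsets : ∀ n → List (Subset n)
subsets zero    = [ Vec.[] ]
subsets (suc n) = map (outside Vec.∷_) (subsets n) ++ map (inside Vec.∷_) (subsets n)

-- The Whitney number f_{n,k}.
f : ℕ → ℕ → ℕ
f n k = length (filter (λ I → isOrderIdeal? I ×-dec (∣ I ∣ ≟ k)) (subsets n))

-- Binomial coefficient that is 0 unless 0 ≤ b ≤ a; for natural a and b,
-- _C_ is already 0 when b > a.
binom : ℤ → ℤ → ℕ
binom (+ a)      (+ b)      = a C b
binom (+ _)      (-[1+ _ ]) = 0
binom (-[1+ _ ]) _          = 0

rising : ℤ → ℕ → ℤ
rising a zero    = + 1
rising a (suc m) = rising a m ℤ.* (a ℤ.+ + m)

-- The guard makes the truncated subtraction k ∸ 2 * j the true difference.
risingTerm : ℕ → ℕ → ℕ → ℚ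
risingTerm k v j =
  if does (2 * j ≤? k)
  then ℚ._/_
         (rising (+ k ℤ.- + (2 * j) ℤ.+ + 1) j
            ℤ.* rising (+ v ℤ.+ + j ℤ.- + k ℤ.+ + 1) (k ∸ 2 * j))
         (j ! * (k ∸ 2 * j) !) {{ j !* (k ∸ 2 * j) !≢0 }}
  else 0ℚ

module _ {c ℓ} (M : RawMonoid c ℓ) where
  open RawMonoid M renaming (ε to 0#)
  open RawMonoidDefs M using (sum)

  -- Σ_{i ≥ 0} t i = s, where only finitely many terms are nonzero.
  HasSum : (ℕ → Carrier) → Carrier → Set ℓ
  HasSum t s = ∃ λ N →
    (∀ i → N ≤ i → t i ≈ 0#) × sum {N} (λ i → t (toℕ i)) ≈ s

  -- Σ_{j ≥ 0} Σ_{r ≥ 0} t j r = s, as an iterated sum.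
  HasDoubleSum : (ℕ → ℕ → Carrier) → Carrier → Set (c ⊔ ℓ)
  HasDoubleSum t s = ∃ λ (inner : ℕ → Carrier) →
    (∀ j → HasSum (t j) (inner j)) × HasSum inner s

-- Cut Z_{2v} into the pairs (z_{2i-1}, z_{2i}). An ideal contains 0, 1 or 2
-- elements of each pair, and it is determined by these numbers: ideals of size k
-- are the words of length v and sum k over {0,1,2} in which 2 is never followed
-- by 0. A word with j twos and m = k - 2j ones arises from one of the C(m+j, j)
-- arrangements of its nonzero letters by inserting v - m - j zeros at the start
-- or after ones, in C(v-j, m) ways; so f_{2v,k} = Σ_j C(k-j, j) C(v-j, k-2j).
-- The j-th summand is the j-th rising-factorial term, and it is also the inner
-- sum over r by trinomial revision and Vandermonde's identity.

module Submission where

open import Defs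
open import Algebra.Definitions.RawMonoid using () renaming (sum to rawSum)
open import Data.Bool.Base using (true; false)
open import Data.Bool.Properties as Bool using ()
open import Data.Fin.Base using (Fin; zero; suc; toℕ)
open import Data.Fin.Subset using (Subset; inside; outside; _∈_; ∣_∣)
open import Data.Fin.Subset.Properties using (drop-there)
open import Data.Integer.Base as ℤ using (ℤ; +_; -[1+_]; _⊖_)
import Data.Integer.Properties as ℤ
open import Data.List.Base using (List; []; _∷_; map; _++_; filter; length)
open import Data.List.Properties using (filter-≐; filter-none; filter-++; length-++)
open import Data.List.Relation.Unary.All as All using ()
open import Data.Nat.Base as ℕ
  using (ℕ; zero; suc; _+_; _*_; _∸_; _≤_; _<_; z≤n; s≤s; s<s⁻¹; _!; NonZero)
open import Data.Nat.Combinatorics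
  using (_C_; nCk+nC[k+1]≡[n+1]C[k+1]; nCn≡1; k>n⇒nCk≡0; nCk≡n!/k![n-k]!; k![n∸k]!∣n!)
open import Data.Nat.Coprimality as Coprime using ()
open import Data.Nat.Divisibility using (∣m+n∣m⇒∣n; ∣m∣n⇒∣m+n; ∣-refl; ∣1⇒≡1)
open import Data.Nat.DivMod using (_/_; m/n*n≡m)
open import Data.Nat.Properties
open import Data.Nat.Solver using (module +-*-Solver)
open import Data.Product.Base using (_×_; _,_; proj₁; proj₂)
open import Data.Rational.Base as ℚ using (ℚ; 0ℚ; mkℚ)
import Data.Rational.Properties as ℚ
open import Data.Rational.Unnormalised.Base using (mkℚᵘ; *≡*)
open import Data.Sum.Base as Sum using (inj₁; inj₂)
open import Data.Unit.Base using (⊤; tt)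
open import Data.Vec.Base using ([]; _∷_; here; there)
open import Function.Base using (_∘_; case_of_)
open import Level using (Level)
open import Relation.Binary.PropositionalEquality
open import Relation.Nullary.Decidable using (Dec; yes; no; does; _×-dec_; dec-true; dec-false)
open import Relation.Nullary.Negation using (¬_)
open import Relation.Unary using (Pred; Decidable; _≐_)

open import Algebra.Properties.CommutativeMonoid.Sum +-0-commutativeMonoid
  using (sum; ∑-distrib-+; sum-cong-≗; sum-replicate-zero)
open import Algebra.Properties.Semiring.Sum +-*-semiring using (*-distribˡ-sum)
open +-*-Solver using (solve; _:=_; _:+_; _:*_; con)
open ≡-Reasoning

private variable
  a p q : Level
  A B : Set a
  n : ℕ

-- Counting list elements and subsets that satisfy a decidable predicate

count : {P : Pred A p} → Decidable P → List A → ℕ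
count P? xs = length (filter P? xs)

count-≐ : {P : Pred A p} {Q : Pred A q} (P? : Decidable P) (Q? : Decidable Q) →
          P ≐ Q → ∀ xs → count P? xs ≡ count Q? xs
count-≐ P? Q? P≐Q xs = cong length (filter-≐ P? Q? P≐Q xs)

count-∅ : {P : Pred A p} (P? : Decidable P) → (∀ x → ¬ P x) → ∀ xs → count P? xs ≡ 0
count-∅ P? ¬P xs = cong length (filter-none P? (All.universal ¬P xs))

count-++ : {P : Pred A p} (P? : Decidable P) →
           ∀ xs ys → count P? (xs ++ ys) ≡ count P? xs + count P? ys
count-++ P? xs ys = trans (cong length (filter-++ P? xs ys)) (length-++ (filter P? xs))

count-map : {P : Pred B p} (P? : Decidable P) (g : A → B) →
            ∀ xs → count P? (map g xs) ≡ count (P? ∘ g) xs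
count-map P? g []       = refl
count-map P? g (x ∷ xs) with does (P? (g x))
... | false = count-map P? g xs
... | true  = cong suc (count-map P? g xs)

count-subsets : {P : Pred (Subset (suc n)) p} (P? : Decidable P) →
  count P? (subsets (suc n)) ≡
  count (P? ∘ (outside ∷_)) (subsets n) + count (P? ∘ (inside ∷_)) (subsets n)
count-subsets {n = n} P? = trans
  (count-++ P? (map (outside ∷_) (subsets n)) (map (inside ∷_) (subsets n)))
  (cong₂ _+_ (count-map P? (outside ∷_) (subsets n)) (count-map P? (inside ∷_) (subsets n)))

-- On coefficient sequences this is multiplication of the generating function by x: one more element
-- in the ideal.
delay : (ℕ → ℕ) → ℕ → ℕ
delay F zero    = 0
delay F (suc k) = F k

delay-cong : ∀ {F G : ℕ → ℕ} → F ≗ G → delay F ≗ delay G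
delay-cong F≗G zero    = refl
delay-cong F≗G (suc k) = F≗G k

count-delay : {P : Pred A p} (P? : Decidable P) (size : A → ℕ) → ∀ xs k →
  count (λ x → P? x ×-dec (suc (size x) ≟ k)) xs ≡
  delay (λ k → count (λ x → P? x ×-dec (size x ≟ k)) xs) k
count-delay P? size xs zero    = count-∅ _ (λ _ ()) xs
count-delay P? size xs (suc k) = count-≐ _ _
  ((λ (px , eq) → px , suc-injective eq) , (λ (px , eq) → px , cong suc eq)) xs

-- Order ideals of a fence, seen from the first pair

-- What z₂ ∈ I requires of the part of I after z₂: if z₃ exists, it is in I.
HeadInside : Subset n → Set
HeadInside []      = ⊤
HeadInside (b ∷ _) = b ≡ inside

headInside? : (I : Subset n) → Dec (HeadInside I)
headInside? []      = yes tt
headInside? (b ∷ _) = b Bool.≟ inside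

Ideal : Subset n → Set
Ideal {n} I = IsOrderIdeal (fence n) (_∈ I)

z₁⋖z₂ : ∀ {n} → _⋖_ {suc (suc n)} zero (suc zero)
z₁⋖z₂ = ∣-refl , inj₁ refl

z₃⋖z₂ : ∀ {n} → _⋖_ {suc (suc (suc n))} (suc (suc zero)) (suc zero)
z₃⋖z₂ = ∣-refl , inj₂ refl

-- A shift by two keeps the parity of labels, so removing a whole pair leaves a fence with the same
-- orientation.
⋖-suc² : {x y : Fin n} → x ⋖ y → Fin.suc (Fin.suc x) ⋖ Fin.suc (Fin.suc y)
⋖-suc² (2∣y , adj) = ∣m∣n⇒∣m+n ∣-refl 2∣y ,
  Sum.map (cong (λ l → 2 + l)) (cong (λ l → 2 + l)) adj

⋖-suc²⁻¹ : {x y : Fin n} → Fin.suc (Fin.suc x) ⋖ Fin.suc (Fin.suc y) → x ⋖ y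
⋖-suc²⁻¹ (2∣y , adj) = ∣m+n∣m⇒∣n 2∣y ∣-refl ,
  Sum.map (suc-injective ∘ suc-injective) (suc-injective ∘ suc-injective) adj

inside∈ : ∀ {n b} {I : Subset n} → zero ∈ (b ∷ I) → b ≡ inside
inside∈ here = refl

ideal-tail² : ∀ {b c} {I : Subset n} → Ideal (b ∷ c ∷ I) → Ideal I
ideal-tail² ideal y z y∈I z⊑y with ⊑⇒≡⊎⋖ z⊑y
... | inj₁ refl = y∈I
... | inj₂ z⋖y  = drop-there (drop-there
  (ideal _ _ (there (there y∈I)) (≡⊎⋖⇒⊑ (inj₂ (⋖-suc² z⋖y)))))

ideal-z₁ : ∀ {b} {I : Subset n} → Ideal (b ∷ inside ∷ I) → b ≡ inside
ideal-z₁ {n} ideal = inside∈ (ideal (suc zero) zero (there here) (≡⊎⋖⇒⊑ (inj₂ (z₁⋖z₂ {n}))))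

ideal-z₃ : ∀ {b} (I : Subset n) → Ideal (b ∷ inside ∷ I) → HeadInside I
ideal-z₃ []      ideal = tt
ideal-z₃ {suc n} (_ ∷ _) ideal = inside∈ (drop-there (drop-there
  (ideal (suc zero) (suc (suc zero)) (there here) (≡⊎⋖⇒⊑ (inj₂ (z₃⋖z₂ {n}))))))

-- Only cover relations need checking. Those below z₂ come from z₁ and z₃, which the first
-- hypothesis supplies; z₁ and z₃ are minimal; all other covers lie in the tail.
ideal-∷∷ : ∀ {b c} {I : Subset n} → (c ≡ inside → b ≡ inside × HeadInside I) →
           Ideal I → Ideal (b ∷ c ∷ I)
ideal-∷∷ {b = b} {c} {I} z₂⇒z₁z₃ ideal y z y∈ z⊑y with ⊑⇒≡⊎⋖ z⊑y
... | inj₁ refl = y∈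
... | inj₂ z⋖y  = below y z y∈ z⋖y
  where
  below : ∀ y z → y ∈ (b ∷ c ∷ I) → z ⋖ y → z ∈ (b ∷ c ∷ I)
  below zero          z             _  (2∣1 , _) = case ∣1⇒≡1 2∣1 of λ ()
  below (suc zero)    zero          (there y∈) _ =
    subst (λ b → zero ∈ (b ∷ c ∷ I)) (sym (proj₁ (z₂⇒z₁z₃ (inside∈ y∈)))) here
  below (suc zero)    (suc zero)    y∈ _         = y∈
  -- The only element after z₂ that z₂ covers is z₃, the head of the tail.
  below (suc zero)    (suc (suc z)) (there y∈) (_ , inj₂ eq) =
    there (there (head z eq (proj₂ (z₂⇒z₁z₃ (inside∈ y∈)))))
    where
    head : ∀ {n} {I : Subset n} (z : Fin n) → label (Fin.suc (Fin.suc z)) ≡ 3 → HeadInside I → z ∈ I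
    head {I = _ ∷ _} zero _ refl = here
  below (suc (suc y)) zero          _ (_ , inj₁ ())
  below (suc (suc y)) zero          _ (_ , inj₂ ())
  below (suc (suc zero)) (suc zero) _ (2∣3 , _)
    with () ← ∣1⇒≡1 (∣m+n∣m⇒∣n {2} {2} {1} 2∣3 ∣-refl)
  below (suc (suc (suc y))) (suc zero) _ (_ , inj₁ ())
  below (suc (suc (suc y))) (suc zero) _ (_ , inj₂ ())
  below (suc (suc y)) (suc (suc z)) (there (there y∈)) z⋖y =
    there (there (ideal y z y∈ (≡⊎⋖⇒⊑ (inj₂ (⋖-suc²⁻¹ z⋖y)))))

-- Recurrences for the numbers of ideals

-- Counts the ideals containing z₁. For `n = 0` the empty ideal is counted, so that z₂ can be the
-- last element of a fence.
fHead : ℕ → ℕ → ℕ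
fHead n k = count (λ I → (headInside? I ×-dec isOrderIdeal? I) ×-dec (∣ I ∣ ≟ k)) (subsets n)

-- An ideal without z₁ also lacks z₂, and its tail is an arbitrary ideal; every other ideal contains
-- z₁.
f-step : ∀ n k → f (suc (suc n)) k ≡ f n k + fHead (suc (suc n)) k
f-step n k = trans (count-subsets ideal?) (cong₂ _+_
  (trans (count-subsets (ideal? ∘ (outside ∷_)))
    (trans (cong₂ _+_
      (count-≐ (λ I → ideal? (outside ∷ outside ∷ I)) _
        ((λ (ideal , eq) → ideal-tail² ideal , eq) ,
         (λ (ideal , eq) → ideal-∷∷ (λ ()) ideal , eq)) (subsets n))
      (count-∅ (λ I → ideal? (outside ∷ inside ∷ I))
        (λ I (ideal , _) → case ideal-z₁ ideal of λ ()) (subsets n)))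
      (+-identityʳ _)))
  (sym (trans (count-subsets headIdeal?) (cong₂ _+_
    (count-∅ (headIdeal? ∘ (outside ∷_)) (λ { _ ((() , _) , _) }) (subsets (suc n)))
    (count-≐ (headIdeal? ∘ (inside ∷_)) (ideal? ∘ (inside ∷_))
      ((λ ((_ , ideal) , eq) → ideal , eq) , (λ (ideal , eq) → (refl , ideal) , eq)) (subsets (suc n)))))))
  where
  ideal? : (I : Subset (suc (suc n))) → Dec (Ideal I × ∣ I ∣ ≡ k)
  ideal? I = isOrderIdeal? I ×-dec (∣ I ∣ ≟ k)
  headIdeal? : (I : Subset (suc (suc n))) → Dec ((HeadInside I × Ideal I) × ∣ I ∣ ≡ k)
  headIdeal? I = (headInside? I ×-dec isOrderIdeal? I) ×-dec (∣ I ∣ ≟ k)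

-- With z₁ present, leaving z₂ out costs one element and frees the tail; including z₂ costs two and
-- forces z₃, if it exists.
fHead-step : ∀ n k → fHead (suc (suc n)) k ≡ delay (f n) k + delay (delay (fHead n)) k
fHead-step n k = trans (count-subsets headIdeal?) (cong₂ _+_
  (count-∅ (headIdeal? ∘ (outside ∷_)) (λ { _ ((() , _) , _) }) (subsets (suc n)))
  (trans (count-subsets (headIdeal? ∘ (inside ∷_))) (cong₂ _+_
    (trans
      (count-≐ (λ I → headIdeal? (inside ∷ outside ∷ I))
               (λ I → isOrderIdeal? I ×-dec (suc ∣ I ∣ ≟ k))
        ((λ ((_ , ideal) , eq) → ideal-tail² ideal , eq) ,
         (λ (ideal , eq) → (refl , ideal-∷∷ (λ ()) ideal) , eq)) (subsets n))
      (count-delay isOrderIdeal? ∣_∣ (subsets n) k))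
    (trans
      (count-≐ (λ I → headIdeal? (inside ∷ inside ∷ I))
               (λ I → (headInside? I ×-dec isOrderIdeal? I) ×-dec (suc (suc ∣ I ∣) ≟ k))
        ((λ {I} ((_ , ideal) , eq) → (ideal-z₃ I ideal , ideal-tail² ideal) , eq) ,
         (λ ((head , ideal) , eq) → (refl , ideal-∷∷ (λ _ → refl , head) ideal) , eq)) (subsets n))
      (trans (count-delay (λ I → headInside? I ×-dec isOrderIdeal? I) (suc ∘ ∣_∣) (subsets n) k)
        (delay-cong (count-delay (λ I → headInside? I ×-dec isOrderIdeal? I) ∣_∣ (subsets n)) k))))))
  where
  headIdeal? : (I : Subset (suc (suc n))) → Dec ((HeadInside I × Ideal I) × ∣ I ∣ ≡ k)
  headIdeal? I = (headInside? I ×-dec isOrderIdeal? I) ×-dec (∣ I ∣ ≟ k)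

-- Words with a given number of twos

-- The number of ways to insert the zeros into the nonzero letters of a word when
-- w letters are not 2, m of them are 1, and the word must not start with 0.
headZeros : ℕ → ℕ → ℕ
headZeros zero    zero    = 1
headZeros zero    (suc m) = 0
headZeros (suc w) zero    = 0
headZeros (suc w) (suc m) = w C m

-- words j w m counts the words with j twos and w other letters, m of which are 1;
-- headWords counts those of them that do not start with 0.
words headWords : ℕ → ℕ → ℕ → ℕ
words j w m = ((m + j) C j) * (w C m)
headWords j w m = ((m + j) C j) * headZeros w m

-- In terms of words, `delayᵛ` prefixes a 0, and `delayᵛ` combined with `delayᵏ` prefixes a 1.
delayᵛ : (ℕ → ℕ → ℕ) → ℕ → ℕ → ℕ
delayᵛ F zero    k = 0
delayᵛ F (suc v) k = F v k

delayᵏ : (ℕ → ℕ → ℕ) → ℕ → ℕ → ℕ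
delayᵏ F v = delay (F v)

-- Either the word starts with 0 and the rest is arbitrary, or it does not. Algebraically this is
-- Pascal's rule for `w C m`.
words-step : ∀ j w m → words j w m ≡ delayᵛ (words j) w m + headWords j w m
words-step j zero    zero    = refl
words-step j zero    (suc m) = refl
words-step j (suc w) zero    = sym (trans (cong (λ t → words j w 0 + t) (*-zeroʳ (j C j))) (+-identityʳ _))
words-step j (suc w) (suc m) = trans
  (cong (((suc m + j) C j) *_)
    (trans (sym (nCk+nC[k+1]≡[n+1]C[k+1] w m)) (+-comm (w C m) _)))
  (*-distribˡ-+ ((suc m + j) C j) (w C suc m) (w C m))

-- Without twos, a nonempty word that does not start with 0 starts with 1. The empty word is
-- excluded by `suc w`.
headWords-zero : ∀ w m → headWords 0 (suc w) m ≡ delayᵛ (delayᵏ (words 0)) (suc w) m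
headWords-zero w zero    = refl
headWords-zero w (suc m) = refl

-- The first letter is 1, followed by anything, or 2, followed by a word that does not start with 0.
-- Pascal's rule splits the arrangements of the nonzero letters in the same way.
headWords-suc : ∀ j w m →
  headWords (suc j) w m ≡ delayᵛ (delayᵏ (words (suc j))) w m + headWords j w m
headWords-suc j zero    zero    = cong (_* 1) (trans (nCn≡1 (suc j)) (sym (nCn≡1 j)))
headWords-suc j zero    (suc m) = trans (*-zeroʳ ((suc m + suc j) C suc j))
  (sym (*-zeroʳ ((suc m + j) C j)))
headWords-suc j (suc w) zero    = trans (*-zeroʳ (suc j C suc j)) (sym (*-zeroʳ (j C j)))
headWords-suc j (suc w) (suc m) = begin
  (suc (m + suc j) C suc j) * (w C m)
    ≡⟨ cong (_* (w C m)) (nCk+nC[k+1]≡[n+1]C[k+1] (m + suc j) j) ⟨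
  ((m + suc j) C j + (m + suc j) C suc j) * (w C m)
    ≡⟨ cong (λ n → (n C j + (m + suc j) C suc j) * (w C m)) (+-suc m j) ⟩
  ((suc m + j) C j + (m + suc j) C suc j) * (w C m)
    ≡⟨ cong (_* (w C m)) (+-comm ((suc m + j) C j) _) ⟩
  ((m + suc j) C suc j + (suc m + j) C j) * (w C m)
    ≡⟨ *-distribʳ-+ (w C m) ((m + suc j) C suc j) _ ⟩
  ((m + suc j) C suc j) * (w C m) + ((suc m + j) C j) * (w C m) ∎

-- From letter counts to length and sum

delay-0 : ∀ k → delay (λ _ → 0) k ≡ 0
delay-0 zero    = refl
delay-0 (suc k) = refl

delay-+ : ∀ F G k → delay (λ k → F k + G k) k ≡ delay F k + delay G k
delay-+ F G zero    = refl
delay-+ F G (suc k) = refl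

delay²-0 : ∀ k → delay (delay (λ _ → 0)) k ≡ 0
delay²-0 k = trans (delay-cong delay-0 k) (delay-0 k)

-- Passes from (number of non-twos, number of ones) to (length, sum) of a word
-- with j twos: F (v - j) (k - 2j), or 0 if one of the differences is negative.
reindex : (ℕ → ℕ → ℕ) → ℕ → ℕ → ℕ → ℕ
reindex F zero    v       k = F v k
reindex F (suc j) zero    k = 0
reindex F (suc j) (suc v) k = delay (delay (reindex F j v)) k

reindex-cong : ∀ {F G : ℕ → ℕ → ℕ} → (∀ w m → F w m ≡ G w m) →
               ∀ j v k → reindex F j v k ≡ reindex G j v k
reindex-cong F≡G zero    v       k = F≡G v k
reindex-cong F≡G (suc j) zero    k = refl
reindex-cong F≡G (suc j) (suc v) k = delay-cong (delay-cong (reindex-cong F≡G j v)) k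

reindex-+ : ∀ F G j v k → reindex (λ w m → F w m + G w m) j v k ≡ reindex F j v k + reindex G j v k
reindex-+ F G zero    v       k = refl
reindex-+ F G (suc j) zero    k = refl
reindex-+ F G (suc j) (suc v) k = trans
  (delay-cong (λ k → trans (delay-cong (reindex-+ F G j v) k) (delay-+ (reindex F j v) _ k)) k)
  (delay-+ (delay (reindex F j v)) _ k)

reindex-delayᵛ : ∀ F j v k → reindex (delayᵛ F) j v k ≡ delayᵛ (reindex F j) v k
reindex-delayᵛ F zero    v             k = refl
reindex-delayᵛ F (suc j) zero          k = refl
reindex-delayᵛ F (suc j) (suc zero)    k =
  trans (delay-cong (delay-cong (reindex-delayᵛ F j zero)) k) (delay²-0 k)
reindex-delayᵛ F (suc j) (suc (suc v)) k = delay-cong (delay-cong (reindex-delayᵛ F j (suc v))) k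

reindex-delayᵏ : ∀ F j v k → reindex (delayᵏ F) j v k ≡ delayᵏ (reindex F j) v k
reindex-delayᵏ F zero    v       k = refl
reindex-delayᵏ F (suc j) zero    k = sym (delay-0 k)
reindex-delayᵏ F (suc j) (suc v) k = delay-cong (delay-cong (reindex-delayᵏ F j v)) k

-- These refine `f (2 * v) k` and `fHead (2 * v) k` by the number `j` of pairs that lie entirely in
-- the ideal.
ideals headIdeals : ℕ → ℕ → ℕ → ℕ
ideals j = reindex (words j) j
headIdeals j = reindex (headWords j) j

ideals-step : ∀ j v k → ideals j (suc v) k ≡ ideals j v k + headIdeals j (suc v) k
ideals-step j v k = begin
  ideals j (suc v) k
    ≡⟨ reindex-cong (words-step j) j (suc v) k ⟩
  reindex (λ w m → delayᵛ (words j) w m + headWords j w m) j (suc v) k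
    ≡⟨ reindex-+ (delayᵛ (words j)) (headWords j) j (suc v) k ⟩
  reindex (delayᵛ (words j)) j (suc v) k + headIdeals j (suc v) k
    ≡⟨ cong (_+ headIdeals j (suc v) k) (reindex-delayᵛ (words j) j (suc v) k) ⟩
  ideals j v k + headIdeals j (suc v) k ∎

headIdeals-zero : ∀ v k → headIdeals 0 (suc v) k ≡ delay (ideals 0 v) k
headIdeals-zero = headWords-zero

headIdeals-suc : ∀ j v k →
  headIdeals (suc j) (suc v) k ≡ delay (ideals (suc j) v) k + delay (delay (headIdeals j v)) k
headIdeals-suc j v k = begin
  headIdeals (suc j) (suc v) k
    ≡⟨ reindex-cong (headWords-suc j) (suc j) (suc v) k ⟩
  reindex (λ w m → delayᵛ (delayᵏ (words (suc j))) w m + headWords j w m) (suc j) (suc v) k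
    -- Reindexing `headWords j` with `suc j` unfolds to a double delay of `headIdeals j`: the
    -- leading 2 adds one to the length and two to the sum.
    ≡⟨ reindex-+ (delayᵛ (delayᵏ (words (suc j)))) (headWords j) (suc j) (suc v) k ⟩
  reindex (delayᵛ (delayᵏ (words (suc j)))) (suc j) (suc v) k + delay (delay (headIdeals j v)) k
    ≡⟨ cong (_+ delay (delay (headIdeals j v)) k)
         (trans (reindex-delayᵛ (delayᵏ (words (suc j))) (suc j) (suc v) k)
                (reindex-delayᵏ (words (suc j)) (suc j) v k)) ⟩
  delay (ideals (suc j) v) k + delay (delay (headIdeals j v)) k ∎

-- Evaluates `reindex` wherever both differences are natural numbers; the next two lemmas give 0
-- elsewhere.
reindex-shift : ∀ F j w m → reindex F j (j + w) (2 * j + m) ≡ F w m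
reindex-shift F zero    w m = refl
reindex-shift F (suc j) w m rewrite +-suc j (j + 0) = reindex-shift F j w m

reindex-v< : ∀ F {j v} k → v < j → reindex F j v k ≡ 0
reindex-v< F {suc j} {zero}  k _         = refl
reindex-v< F {suc j} {suc v} k (s≤s v<j) =
  trans (delay-cong (delay-cong (λ k → reindex-v< F k v<j)) k) (delay²-0 k)

reindex-k< : ∀ F j v {k} → k < 2 * j → reindex F j v k ≡ 0
reindex-k< F (suc j) zero    k<2j = refl
reindex-k< F (suc j) (suc v) {zero} k<2j = refl
reindex-k< F (suc j) (suc v) {suc zero} k<2j = refl
reindex-k< F (suc j) (suc v) {suc (suc k)} k<2j rewrite +-suc j (j + 0) =
  reindex-k< F j v (s<s⁻¹ (s<s⁻¹ k<2j))

-- Summing over the number of twos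

∑ : ℕ → (ℕ → ℕ) → ℕ
∑ N t = sum {N} (λ i → t (toℕ i))

∑-cong : ∀ N {t u : ℕ → ℕ} → (∀ i → t i ≡ u i) → ∑ N t ≡ ∑ N u
∑-cong N t≡u = sum-cong-≗ {N} (λ i → t≡u (toℕ i))

∑-+ : ∀ N t u → ∑ N (λ i → t i + u i) ≡ ∑ N t + ∑ N u
∑-+ N t u = ∑-distrib-+ {N} (λ i → t (toℕ i)) (λ i → u (toℕ i))

∑-0 : ∀ N → ∑ N (λ _ → 0) ≡ 0
∑-0 N = sum-replicate-zero N

∑-delay : ∀ N (F : ℕ → ℕ → ℕ) k → ∑ N (λ j → delay (F j) k) ≡ delay (λ k → ∑ N (λ j → F j k)) k
∑-delay N F zero    = ∑-0 N
∑-delay N F (suc k) = refl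

-- Mutual induction on `v`: both sides obey the same recurrences. The bound `N` is arbitrary because
-- removing a leading 2 lowers the length and the number of twos together, so the induction needs
-- `N` lowered as well.
f≡∑ideals : ∀ {v N} k → v < N → f (2 * v) k ≡ ∑ N (λ j → ideals j v k)
fHead≡∑headIdeals : ∀ {v N} k → v < N → fHead (2 * v) k ≡ ∑ N (λ j → headIdeals j v k)

f≡∑ideals {zero} {suc N} zero    _ = cong suc (sym (∑-0 N))
f≡∑ideals {zero} {suc N} (suc k) _ = sym (∑-0 N)
f≡∑ideals {suc v} {N} k v<N = begin
  f (2 * suc v) k
    ≡⟨ cong (λ n → f n k) (*-suc 2 v) ⟩
  f (2 + 2 * v) k
    ≡⟨ f-step (2 * v) k ⟩
  f (2 * v) k + fHead (2 + 2 * v) k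
    ≡⟨ cong (λ n → f (2 * v) k + fHead n k) (*-suc 2 v) ⟨
  f (2 * v) k + fHead (2 * suc v) k
    ≡⟨ cong₂ _+_ (f≡∑ideals k (<⇒≤ v<N)) (fHead≡∑headIdeals k v<N) ⟩
  ∑ N (λ j → ideals j v k) + ∑ N (λ j → headIdeals j (suc v) k)
    ≡⟨ ∑-+ N (λ j → ideals j v k) (λ j → headIdeals j (suc v) k) ⟨
  ∑ N (λ j → ideals j v k + headIdeals j (suc v) k)
    ≡⟨ ∑-cong N (λ j → ideals-step j v k) ⟨
  ∑ N (λ j → ideals j (suc v) k) ∎

fHead≡∑headIdeals {zero} {suc N} zero    _ = cong suc (sym (∑-0 N))
fHead≡∑headIdeals {zero} {suc N} (suc k) _ = sym (∑-0 N)
fHead≡∑headIdeals {suc v} {suc N} k v<N@(s≤s v<N-1) = begin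
  fHead (2 * suc v) k
    ≡⟨ cong (λ n → fHead n k) (*-suc 2 v) ⟩
  fHead (2 + 2 * v) k
    ≡⟨ fHead-step (2 * v) k ⟩
  delay (f (2 * v)) k + delay (delay (fHead (2 * v))) k
    ≡⟨ cong₂ _+_ (delay-cong (λ k → f≡∑ideals k (<⇒≤ v<N)) k)
                 (delay-cong (delay-cong (λ k → fHead≡∑headIdeals k v<N-1)) k) ⟩
  delay (λ k → ∑ (suc N) (λ j → ideals j v k)) k + delay (delay (λ k → ∑ N (λ j → headIdeals j v k))) k
    ≡⟨ cong₂ _+_ (∑-delay (suc N) (λ j → ideals j v) k)
                 (trans (∑-delay N (λ j → delay (headIdeals j v)) k)
                        (delay-cong (∑-delay N (λ j → headIdeals j v)) k)) ⟨
  delay (ideals 0 v) k + ∑ N (λ j → delay (ideals (suc j) v) k) + ∑ N (λ j → delay (delay (headIdeals j v)) k)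
    ≡⟨ +-assoc (delay (ideals 0 v) k) _ _ ⟩
  delay (ideals 0 v) k + (∑ N (λ j → delay (ideals (suc j) v) k) + ∑ N (λ j → delay (delay (headIdeals j v)) k))
    ≡⟨ cong (λ t → delay (ideals 0 v) k + t)
         (∑-+ N (λ j → delay (ideals (suc j) v) k) (λ j → delay (delay (headIdeals j v)) k)) ⟨
  delay (ideals 0 v) k + ∑ N (λ j → delay (ideals (suc j) v) k + delay (delay (headIdeals j v)) k)
    -- The summand for `j = 0` stands alone, since a word without twos cannot start with 2.
    ≡⟨ cong₂ _+_ (headIdeals-zero v k) (∑-cong N (λ j → headIdeals-suc j v k)) ⟨
  ∑ (suc N) (λ j → headIdeals j (suc v) k) ∎

-- Vandermonde's identity and trinomial revision

-- This is the usual convolution after `j C r` is read as `j C (j ∸ r)`. The offset `s` is general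
-- because Pascal's rule on `suc j` produces a second sum with offset `suc s`.
vandermonde : ∀ {j N} m s → j < N → ∑ N (λ r → (j C r) * (m C (s + r))) ≡ (m + j) C (j + s)
vandermonde {zero} {suc N} m s _ = begin
  1 * (m C (s + 0)) + ∑ N (λ r → 0)
    ≡⟨ cong₂ _+_ (*-identityˡ _) (∑-0 N) ⟩
  (m C (s + 0)) + 0   ≡⟨ +-identityʳ _ ⟩
  m C (s + 0)         ≡⟨ cong₂ _C_ (sym (+-identityʳ m)) (+-identityʳ s) ⟩
  (m + 0) C s         ∎
vandermonde {suc j} {suc N} m s (s≤s j<N) = begin
  1 * (m C (s + 0)) + ∑ N (λ r → (suc j C suc r) * (m C (s + suc r)))
    ≡⟨ cong (λ t → 1 * (m C (s + 0)) + t) (∑-cong N pascal) ⟩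
  1 * (m C (s + 0)) + ∑ N (λ r → (j C suc r) * (m C (s + suc r)) + (j C r) * (m C (suc s + r)))
    ≡⟨ cong (λ t → 1 * (m C (s + 0)) + t)
         (∑-+ N (λ r → (j C suc r) * (m C (s + suc r))) (λ r → (j C r) * (m C (suc s + r)))) ⟩
  1 * (m C (s + 0)) + (∑ N (λ r → (j C suc r) * (m C (s + suc r))) + ∑ N (λ r → (j C r) * (m C (suc s + r))))
    ≡⟨ +-assoc (1 * (m C (s + 0))) _ _ ⟨
  ∑ (suc N) (λ r → (j C r) * (m C (s + r))) + ∑ N (λ r → (j C r) * (m C (suc s + r)))
    ≡⟨ cong₂ _+_ (vandermonde m s (m<n⇒m<1+n j<N)) (vandermonde m (suc s) j<N) ⟩
  (m + j) C (j + s) + (m + j) C (j + suc s)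
    ≡⟨ cong (λ k → (m + j) C (j + s) + (m + j) C k) (+-suc j s) ⟩
  (m + j) C (j + s) + (m + j) C suc (j + s)
    ≡⟨ nCk+nC[k+1]≡[n+1]C[k+1] (m + j) (j + s) ⟩
  suc (m + j) C suc (j + s)
    ≡⟨ cong (_C suc (j + s)) (+-suc m j) ⟨
  (m + suc j) C suc (j + s) ∎
  where
  pascal : ∀ r → (suc j C suc r) * (m C (s + suc r)) ≡
                 (j C suc r) * (m C (s + suc r)) + (j C r) * (m C (suc s + r))
  pascal r = begin
    (suc j C suc r) * (m C (s + suc r))
      ≡⟨ cong (_* (m C (s + suc r))) (trans (sym (nCk+nC[k+1]≡[n+1]C[k+1] j r)) (+-comm (j C r) _)) ⟩
    ((j C suc r) + (j C r)) * (m C (s + suc r))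
      ≡⟨ *-distribʳ-+ (m C (s + suc r)) (j C suc r) _ ⟩
    (j C suc r) * (m C (s + suc r)) + (j C r) * (m C (s + suc r))
      ≡⟨ cong (λ k → (j C suc r) * (m C (s + suc r)) + (j C r) * (m C k)) (+-suc s r) ⟩
    (j C suc r) * (m C (s + suc r)) + (j C r) * (m C (suc s + r)) ∎

[a+b]Cb*b!*a! : ∀ a b → ((a + b) C b) * (b ! * a !) ≡ (a + b) !
[a+b]Cb*b!*a! a b = begin
  ((a + b) C b) * (b ! * a !)
    ≡⟨ cong (λ c → ((a + b) C b) * (b ! * c !)) (m+n∸n≡m a b) ⟨
  ((a + b) C b) * (b ! * (a + b ∸ b) !)
    ≡⟨ cong (_* (b ! * (a + b ∸ b) !)) (nCk≡n!/k![n-k]! (m≤n+m b a)) ⟩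
  ((a + b) ! / (b ! * (a + b ∸ b) !)) * (b ! * (a + b ∸ b) !)
    ≡⟨ m/n*n≡m (k![n∸k]!∣n! (m≤n+m b a)) ⟩
  (a + b) ! ∎
  where instance _ = b !* (a + b ∸ b) !≢0

-- Multiplied by `a ! * (b ! * c !)`, both sides become `(c + b + a) !`.
trinomial : ∀ a b c → ((c + b + a) C a) * ((c + b) C b) ≡ ((c + (b + a)) C (b + a)) * ((b + a) C a)
trinomial a b c = *-cancelʳ-≡ _ _ (a ! * (b ! * c !)) (begin
  ((c + b + a) C a) * ((c + b) C b) * (a ! * (b ! * c !))
    ≡⟨ solve 5 (λ p q x y z → p :* q :* (x :* (y :* z)) := p :* (x :* (q :* (y :* z)))) refl
         ((c + b + a) C a) ((c + b) C b) (a !) (b !) (c !) ⟩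
  ((c + b + a) C a) * (a ! * (((c + b) C b) * (b ! * c !)))
    ≡⟨ cong (λ t → ((c + b + a) C a) * (a ! * t)) ([a+b]Cb*b!*a! c b) ⟩
  ((c + b + a) C a) * (a ! * (c + b) !)
    ≡⟨ [a+b]Cb*b!*a! (c + b) a ⟩
  (c + b + a) !
    ≡⟨ cong _! (+-assoc c b a) ⟩
  (c + (b + a)) !
    ≡⟨ [a+b]Cb*b!*a! c (b + a) ⟨
  ((c + (b + a)) C (b + a)) * ((b + a) ! * c !)
    ≡⟨ cong (λ t → ((c + (b + a)) C (b + a)) * (t * c !)) ([a+b]Cb*b!*a! b a) ⟨
  ((c + (b + a)) C (b + a)) * (((b + a) C a) * (a ! * b !) * c !)
    ≡⟨ solve 5 (λ p q x y z → p :* (q :* (x :* y) :* z) := p :* q :* (x :* (y :* z))) refl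
         ((c + (b + a)) C (b + a)) ((b + a) C a) (a !) (b !) (c !) ⟩
  ((c + (b + a)) C (b + a)) * ((b + a) C a) * (a ! * (b ! * c !)) ∎)
  where
  instance
    _ = b !* c !≢0
    _ = m*n≢0 (a !) (b ! * c !) {{ a !≢0 }}

trinomial-revision : ∀ {w r} m → r ≤ w → r ≤ m →
                     (w C r) * ((w ∸ r) C (m ∸ r)) ≡ (w C m) * (m C r)
trinomial-revision {w} {r} m r≤w r≤m with m ≤? w
... | no  m≰w = begin
  (w C r) * ((w ∸ r) C (m ∸ r)) ≡⟨ cong ((w C r) *_) (k>n⇒nCk≡0 (∸-monoˡ-< (≰⇒> m≰w) r≤w)) ⟩
  (w C r) * 0                   ≡⟨ *-zeroʳ (w C r) ⟩
  0                             ≡⟨ cong (_* (m C r)) (k>n⇒nCk≡0 (≰⇒> m≰w)) ⟨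
  (w C m) * (m C r)             ∎
... | yes m≤w = begin
  (w C r) * ((w ∸ r) C (m ∸ r))
    ≡⟨ cong₂ (λ w n → (w C r) * (n C (m ∸ r))) c+b+r≡w c+b≡w∸r ⟨
  ((c + b + r) C r) * ((c + b) C b)
    ≡⟨ trinomial r b c ⟩
  ((c + (b + r)) C (b + r)) * ((b + r) C r)
    ≡⟨ cong (λ m → ((c + m) C m) * (m C r)) (m∸n+n≡m r≤m) ⟩
  ((c + m) C m) * (m C r)
    ≡⟨ cong (λ w → (w C m) * (m C r)) (m∸n+n≡m m≤w) ⟩
  (w C m) * (m C r) ∎
  where
  b c : ℕ
  b = m ∸ r
  c = w ∸ m
  c+b+r≡w : c + b + r ≡ w
  c+b+r≡w = begin
    c + b + r   ≡⟨ +-assoc c b r ⟩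
    c + (b + r) ≡⟨ cong (λ m → c + m) (m∸n+n≡m r≤m) ⟩
    c + m       ≡⟨ m∸n+n≡m m≤w ⟩
    w           ∎
  c+b≡w∸r : c + b ≡ w ∸ r
  c+b≡w∸r = trans (sym (m+n∸n≡m (c + b) r)) (cong (_∸ r) c+b+r≡w)

-- Integer binomials and rising factorials

binom-⊖ : ∀ {m n} a → m < n → binom a (m ⊖ n) ≡ 0
binom-⊖ {zero}  {suc n} (+ _)      _ = refl
binom-⊖ {zero}  {suc n} (-[1+ _ ]) _ = refl
binom-⊖ {suc m} {suc n} a (s≤s m<n)  =
  trans (cong (binom a) (ℤ.[1+m]⊖[1+n]≡m⊖n m n)) (binom-⊖ a m<n)

⊖-binom : ∀ {m n} b → m < n → binom (m ⊖ n) b ≡ 0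
⊖-binom {zero}  {suc n} b _ = refl
⊖-binom {suc m} {suc n} b (s≤s m<n) =
  trans (cong (λ a → binom a b) (ℤ.[1+m]⊖[1+n]≡m⊖n m n)) (⊖-binom b m<n)

risingℕ : ℕ → ℕ → ℕ
risingℕ a zero    = 1
risingℕ a (suc m) = risingℕ a m * (a + m)

rising-+ : ∀ a m → rising (+ a) m ≡ + risingℕ a m
rising-+ a zero    = refl
rising-+ a (suc m) = trans (cong (ℤ._* (+ (a + m))) (rising-+ a m)) (sym (ℤ.pos-* (risingℕ a m) (a + m)))

risingℕ-! : ∀ c m → risingℕ (suc c) m * c ! ≡ (c + m) !
risingℕ-! c zero    = trans (*-identityˡ (c !)) (cong _! (sym (+-identityʳ c)))
risingℕ-! c (suc m) = begin
  risingℕ (suc c) m * suc (c + m) * c !   ≡⟨ cong (_* c !) (*-comm (risingℕ (suc c) m) (suc (c + m))) ⟩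
  suc (c + m) * risingℕ (suc c) m * c !   ≡⟨ *-assoc (suc (c + m)) (risingℕ (suc c) m) (c !) ⟩
  suc (c + m) * (risingℕ (suc c) m * c !) ≡⟨ cong (suc (c + m) *_) (risingℕ-! c m) ⟩
  suc (c + m) !                           ≡⟨ cong _! (+-suc c m) ⟨
  (c + suc m) !                           ∎

-- The rising factorial equals (c+m)!/c!; multiplying by `c !` avoids the division.
rising-C : ∀ c m → rising (+ suc c) m ≡ + (((c + m) C m) * m !)
rising-C c m = trans (rising-+ (suc c) m) (cong +_ (*-cancelʳ-≡ _ _ (c !) (begin
  risingℕ (suc c) m * c !       ≡⟨ risingℕ-! c m ⟩
  (c + m) !                     ≡⟨ [a+b]Cb*b!*a! c m ⟨
  ((c + m) C m) * (m ! * c !)   ≡⟨ *-assoc ((c + m) C m) (m !) (c !) ⟨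
  ((c + m) C m) * m ! * c !     ∎)))
  where instance _ = c !≢0

-- The product runs through the factor `- n + n`.
rising-0 : ∀ {n m} → n < m → rising (ℤ.- + n) m ≡ + 0
rising-0 {n} {suc m} (s≤s n≤m) with m≤n⇒m<n∨m≡n n≤m
... | inj₁ n<m  = cong (ℤ._* (ℤ.- + n ℤ.+ + m)) (rising-0 n<m)
... | inj₂ refl = trans (cong (rising (ℤ.- + n) n ℤ.*_) (ℤ.+-inverseˡ (+ n))) (ℤ.*-zeroʳ (rising (ℤ.- + n) n))

rising-⊖ : ∀ w m → rising (w ⊖ m ℤ.+ + 1) m ≡ + ((w C m) * m !)
rising-⊖ w m with m ≤? w
... | yes m≤w = begin
  rising (w ⊖ m ℤ.+ + 1) m   ≡⟨ cong (λ a → rising (a ℤ.+ + 1) m) (ℤ.⊖-≥ m≤w) ⟩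
  rising (+ (w ∸ m + 1)) m   ≡⟨ cong (λ a → rising (+ a) m) (+-comm (w ∸ m) 1) ⟩
  rising (+ suc (w ∸ m)) m   ≡⟨ rising-C (w ∸ m) m ⟩
  + (((w ∸ m + m) C m) * m !)  ≡⟨ cong (λ a → + ((a C m) * m !)) (m∸n+n≡m m≤w) ⟩
  + ((w C m) * m !)          ∎
-- Here `m = suc (w + d)`, so the product starts at `- d` and passes through 0, in agreement with
-- `w C m` being 0.
... | no m≰w with d , refl ← m≤n⇒∃[o]m+o≡n (≰⇒> m≰w) = begin
  rising (w ⊖ m ℤ.+ + 1) m   ≡⟨ cong (λ a → rising a m) eq ⟩
  rising (ℤ.- + d) m         ≡⟨ rising-0 (s≤s (m≤n+m d w)) ⟩
  + 0                        ≡⟨ cong (λ a → + (a * m !)) (k>n⇒nCk≡0 (≰⇒> m≰w)) ⟨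
  + ((w C m) * m !)          ∎
  where
  eq : w ⊖ suc (w + d) ℤ.+ + 1 ≡ ℤ.- + d
  eq = begin
    w ⊖ suc (w + d) ℤ.+ + 1   ≡⟨ cong₂ (λ a b → a ⊖ b ℤ.+ + 1) (+-identityʳ w) (+-suc w d) ⟨
    (w + 0) ⊖ (w + suc d) ℤ.+ + 1 ≡⟨ cong (ℤ._+ + 1) (ℤ.+-cancelˡ-⊖ w 0 (suc d)) ⟩
    1 ⊖ suc d                 ≡⟨ ℤ.[1+m]⊖[1+n]≡m⊖n 0 d ⟩
    0 ⊖ d                     ≡⟨ ℤ.⊖-≤ {0} {d} z≤n ⟩
    ℤ.- + d                   ∎

-- Natural numbers as rationals

/-cancel : ∀ a d .{{_ : NonZero d}} → (+ (a * d)) ℚ./ d ≡ (+ a) ℚ./ 1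
/-cancel a d@(suc d-1) = ℚ.fromℚᵘ-cong {mkℚᵘ (+ (a * d)) d-1} {mkℚᵘ (+ a) 0}
  (*≡* (trans (ℤ.*-identityʳ (+ (a * d))) (ℤ.pos-* a d)))

/1-+ : ∀ a b → (+ a) ℚ./ 1 ℚ.+ (+ b) ℚ./ 1 ≡ (+ (a + b)) ℚ./ 1
/1-+ a b = begin
  (+ a) ℚ./ 1 ℚ.+ (+ b) ℚ./ 1
    ≡⟨ cong₂ ℚ._+_ (/1 a) (/1 b) ⟩
  (+ a ℤ.* + 1 ℤ.+ + b ℤ.* + 1) ℚ./ 1
    ≡⟨ ℚ./-cong {q₁ = 1} (cong₂ ℤ._+_ (ℤ.*-identityʳ (+ a)) (ℤ.*-identityʳ (+ b))) refl ⟩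
  (+ (a + b)) ℚ./ 1 ∎
  where
  /1 : ∀ c → (+ c) ℚ./ 1 ≡ mkℚ (+ c) 0 (Coprime.sym (Coprime.1-coprimeTo c))
  /1 c = ℚ.normalize-coprime _

-- The double sum

-- Trinomial revision without range conditions: if `r` exceeds `m` or `w`, both sides vanish.
binom-revision : ∀ w m r → (w C r) * binom (w ⊖ r) (m ⊖ r) ≡ (w C m) * (m C r)
binom-revision w m r with r ≤? m | r ≤? w
... | no r≰m | _ = begin
  (w C r) * binom (w ⊖ r) (m ⊖ r) ≡⟨ cong ((w C r) *_) (binom-⊖ (w ⊖ r) (≰⇒> r≰m)) ⟩
  (w C r) * 0                     ≡⟨ *-zeroʳ (w C r) ⟩
  0                               ≡⟨ *-zeroʳ (w C m) ⟨
  (w C m) * 0                     ≡⟨ cong ((w C m) *_) (k>n⇒nCk≡0 (≰⇒> r≰m)) ⟨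
  (w C m) * (m C r)               ∎
... | yes r≤m | no r≰w = begin
  (w C r) * binom (w ⊖ r) (m ⊖ r) ≡⟨ cong (_* binom (w ⊖ r) (m ⊖ r)) (k>n⇒nCk≡0 (≰⇒> r≰w)) ⟩
  0                               ≡⟨ cong (_* (m C r)) (k>n⇒nCk≡0 (<-≤-trans (≰⇒> r≰w) r≤m)) ⟨
  (w C m) * (m C r)               ∎
... | yes r≤m | yes r≤w = begin
  (w C r) * binom (w ⊖ r) (m ⊖ r)   ≡⟨ cong ((w C r) *_) (cong₂ binom (ℤ.⊖-≥ r≤w) (ℤ.⊖-≥ r≤m)) ⟩
  (w C r) * ((w ∸ r) C (m ∸ r))     ≡⟨ trinomial-revision m r≤w r≤m ⟩
  (w C m) * (m C r)                 ∎

doubleTerm : ℕ → ℕ → ℕ → ℕ → ℕ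
doubleTerm k v j r = binom (+ j) (+ r)
                     * binom (+ v ℤ.- + j) (+ r)
                     * binom (+ v ℤ.- + (j + r)) (+ k ℤ.- + (2 * j + r))

[n+a]-[n+b] : ∀ n a b → + (n + a) ℤ.- + (n + b) ≡ a ⊖ b
[n+a]-[n+b] n a b = trans (ℤ.m-n≡m⊖n (n + a) (n + b)) (ℤ.+-cancelˡ-⊖ n a b)

[n+a]-n : ∀ n a → + (n + a) ℤ.- + n ≡ + a
[n+a]-n n a = begin
  + (n + a) ℤ.- + n       ≡⟨ cong (λ b → + (n + a) ℤ.- + b) (+-identityʳ n) ⟨
  + (n + a) ℤ.- + (n + 0) ≡⟨ [n+a]-[n+b] n a 0 ⟩
  + a                     ∎

-- Revision pulls out a factor independent of `r` and leaves a Vandermonde summand.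
doubleTerm-C : ∀ j w m r → doubleTerm (2 * j + m) (j + w) j r ≡ (w C m) * ((j C r) * (m C r))
doubleTerm-C j w m r = begin
  doubleTerm (2 * j + m) (j + w) j r
    ≡⟨ cong₂ (λ a b → (j C r) * binom a (+ r) * b) ([n+a]-n j w)
         (cong₂ binom ([n+a]-[n+b] j w r) ([n+a]-[n+b] (2 * j) m r)) ⟩
  (j C r) * (w C r) * binom (w ⊖ r) (m ⊖ r)
    ≡⟨ *-assoc (j C r) (w C r) _ ⟩
  (j C r) * ((w C r) * binom (w ⊖ r) (m ⊖ r))
    ≡⟨ cong ((j C r) *_) (binom-revision w m r) ⟩
  (j C r) * ((w C m) * (m C r))
    ≡⟨ *-assoc (j C r) (w C m) _ ⟨
  (j C r) * (w C m) * (m C r)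
    ≡⟨ cong (_* (m C r)) (*-comm (j C r) (w C m)) ⟩
  (w C m) * (j C r) * (m C r)
    ≡⟨ *-assoc (w C m) (j C r) _ ⟩
  (w C m) * ((j C r) * (m C r)) ∎

doubleTerm-v< : ∀ k {v j} r → v < j → doubleTerm k v j r ≡ 0
doubleTerm-v< k {v} {j} r v<j = cong (_* binom (+ v ℤ.- + (j + r)) (+ k ℤ.- + (2 * j + r))) (begin
  (j C r) * binom (+ v ℤ.- + j) (+ r) ≡⟨ cong (λ a → (j C r) * binom a (+ r)) (ℤ.m-n≡m⊖n v j) ⟩
  (j C r) * binom (v ⊖ j) (+ r)       ≡⟨ cong ((j C r) *_) (⊖-binom (+ r) v<j) ⟩
  (j C r) * 0                         ≡⟨ *-zeroʳ (j C r) ⟩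
  0                                   ∎)

doubleTerm-k< : ∀ {k} v j r → k < 2 * j → doubleTerm k v j r ≡ 0
doubleTerm-k< {k} v j r k<2j = begin
  doubleTerm k v j r            ≡⟨ cong (λ b → c * binom top b) (ℤ.m-n≡m⊖n k (2 * j + r)) ⟩
  c * binom top (k ⊖ (2 * j + r)) ≡⟨ cong (c *_) (binom-⊖ top (<-≤-trans k<2j (m≤m+n (2 * j) r))) ⟩
  c * 0                         ≡⟨ *-zeroʳ c ⟩
  0                             ∎
  where
  top : ℤ
  top = + v ℤ.- + (j + r)
  c : ℕ
  c = (j C r) * binom (+ v ℤ.- + j) (+ r)

∑doubleTerm≡ideals : ∀ k v j → ∑ (suc j) (doubleTerm k v j) ≡ ideals j v k
∑doubleTerm≡ideals k v j with j ≤? v | 2 * j ≤? k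
... | no j≰v | _ = begin
  ∑ (suc j) (doubleTerm k v j) ≡⟨ ∑-cong (suc j) (λ r → doubleTerm-v< k r (≰⇒> j≰v)) ⟩
  ∑ (suc j) (λ _ → 0)          ≡⟨ ∑-0 (suc j) ⟩
  0                            ≡⟨ reindex-v< (words j) k (≰⇒> j≰v) ⟨
  ideals j v k                 ∎
... | yes _ | no 2j≰k = begin
  ∑ (suc j) (doubleTerm k v j) ≡⟨ ∑-cong (suc j) (λ r → doubleTerm-k< v j r (≰⇒> 2j≰k)) ⟩
  ∑ (suc j) (λ _ → 0)          ≡⟨ ∑-0 (suc j) ⟩
  0                            ≡⟨ reindex-k< (words j) j v (≰⇒> 2j≰k) ⟨
  ideals j v k                 ∎
... | yes j≤v | yes 2j≤k
  with w , refl ← m≤n⇒∃[o]m+o≡n j≤v | m , refl ← m≤n⇒∃[o]m+o≡n 2j≤k = begin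
  ∑ (suc j) (doubleTerm (2 * j + m) (j + w) j)
    ≡⟨ ∑-cong (suc j) (doubleTerm-C j w m) ⟩
  ∑ (suc j) (λ r → (w C m) * ((j C r) * (m C r)))
    ≡⟨ *-distribˡ-sum {suc j} (w C m) (λ r → (j C toℕ r) * (m C toℕ r)) ⟨
  (w C m) * ∑ (suc j) (λ r → (j C r) * (m C r))
    ≡⟨ cong ((w C m) *_) (vandermonde m 0 (n<1+n j)) ⟩
  (w C m) * ((m + j) C (j + 0))
    ≡⟨ cong (λ i → (w C m) * ((m + j) C i)) (+-identityʳ j) ⟩
  (w C m) * ((m + j) C j)
    ≡⟨ *-comm (w C m) _ ⟩
  words j w m
    ≡⟨ reindex-shift (words j) j w m ⟨
  ideals j (j + w) (2 * j + m) ∎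

-- The rising-factorial sum

risingTerm-k< : ∀ {k} v {j} → k < 2 * j → risingTerm k v j ≡ 0ℚ
risingTerm-k< {k} v {j} k<2j rewrite dec-false (2 * j ≤? k) (<⇒≱ k<2j) = refl

-- The rising factorials are (m+1)_j and (w-m+1)_m, that is, `(m + j) C j` times `j !` and `w C m`
-- times `m !`; the denominator cancels the factorials.
risingTerm-C : ∀ j w m → risingTerm (2 * j + m) (j + w) j ≡ + words j w m ℚ./ 1
risingTerm-C j w m rewrite dec-true (2 * j ≤? 2 * j + m) (m≤m+n (2 * j) m) = begin
  (rising (+ k ℤ.- + (2 * j) ℤ.+ + 1) j ℤ.* rising (+ v ℤ.+ + j ℤ.- + k ℤ.+ + 1) (k ∸ 2 * j))
    ℚ./ (j ! * (k ∸ 2 * j) !)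
    ≡⟨ ℚ./-cong numerator (cong (λ n → j ! * n !) (m+n∸m≡n (2 * j) m)) ⟩
  (+ (words j w m * (j ! * m !))) ℚ./ (j ! * m !)
    ≡⟨ /-cancel (words j w m) (j ! * m !) ⟩
  (+ words j w m) ℚ./ 1 ∎
  where
  k v : ℕ
  k = 2 * j + m
  v = j + w
  instance
    _ = j !* m !≢0
    _ = j !* (k ∸ 2 * j) !≢0
  v+j-k : + v ℤ.+ + j ℤ.- + k ≡ w ⊖ m
  v+j-k = begin
    + (j + w + j) ℤ.- + (2 * j + m) ≡⟨ cong (λ n → + n ℤ.- + (2 * j + m))
      (solve 2 (λ j w → j :+ w :+ j := con 2 :* j :+ w) refl j w) ⟩
    + (2 * j + w) ℤ.- + (2 * j + m) ≡⟨ [n+a]-[n+b] (2 * j) w m ⟩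
    w ⊖ m                           ∎
  numerator : rising (+ k ℤ.- + (2 * j) ℤ.+ + 1) j ℤ.* rising (+ v ℤ.+ + j ℤ.- + k ℤ.+ + 1) (k ∸ 2 * j)
              ≡ + (words j w m * (j ! * m !))
  numerator = begin
    rising (+ k ℤ.- + (2 * j) ℤ.+ + 1) j ℤ.* rising (+ v ℤ.+ + j ℤ.- + k ℤ.+ + 1) (k ∸ 2 * j)
      ≡⟨ cong₂ (λ a n → rising (a ℤ.+ + 1) j ℤ.* rising (+ v ℤ.+ + j ℤ.- + k ℤ.+ + 1) n)
               ([n+a]-n (2 * j) m) (m+n∸m≡n (2 * j) m) ⟩
    rising (+ (m + 1)) j ℤ.* rising (+ v ℤ.+ + j ℤ.- + k ℤ.+ + 1) m
      ≡⟨ cong₂ (λ n a → rising (+ n) j ℤ.* rising (a ℤ.+ + 1) m) (+-comm m 1) v+j-k ⟩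
    rising (+ suc m) j ℤ.* rising (w ⊖ m ℤ.+ + 1) m
      ≡⟨ cong₂ ℤ._*_ (rising-C m j) (rising-⊖ w m) ⟩
    + (((m + j) C j) * j !) ℤ.* + ((w C m) * m !)
      ≡⟨ ℤ.pos-* (((m + j) C j) * j !) ((w C m) * m !) ⟨
    + (((m + j) C j) * j ! * ((w C m) * m !))
      ≡⟨ cong +_ (solve 4 (λ a b c d → a :* b :* (c :* d) := a :* c :* (b :* d)) refl
           ((m + j) C j) (j !) (w C m) (m !)) ⟩
    + (words j w m * (j ! * m !)) ∎

risingTerm≡ideals : ∀ {k} v j → k ≤ 2 * v → risingTerm k v j ≡ + ideals j v k ℚ./ 1
risingTerm≡ideals {k} v j k≤2v with 2 * j ≤? k
... | no  2j≰k = trans (risingTerm-k< v {j} (≰⇒> 2j≰k))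
                       (cong (λ n → + n ℚ./ 1) (sym (reindex-k< (words j) j v (≰⇒> 2j≰k))))
... | yes 2j≤k
  -- The bound `k ≤ 2 * v` gives `j ≤ v`. A `j > v` with `2 * j ≡ k` would have the term 1, although
  -- `ideals` is 0 there.
  with w , refl ← m≤n⇒∃[o]m+o≡n (*-cancelˡ-≤ {j} {v} 2 (≤-trans 2j≤k k≤2v))
     | m , refl ← m≤n⇒∃[o]m+o≡n 2j≤k =
  trans (risingTerm-C j w m) (cong (λ n → + n ℚ./ 1) (sym (reindex-shift (words j) j w m)))

sum-/1 : ∀ N {t : ℕ → ℚ} (u : ℕ → ℕ) → (∀ i → t i ≡ + u i ℚ./ 1) →
         rawSum ℚ.+-0-rawMonoid {N} (λ i → t (toℕ i)) ≡ + ∑ N u ℚ./ 1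
sum-/1 zero    u t≡u = refl
sum-/1 (suc N) u t≡u =
  trans (cong₂ ℚ._+_ (t≡u 0) (sum-/1 N (λ i → u (suc i)) (λ i → t≡u (suc i)))) (/1-+ (u 0) _)

theorem2p6 : (k v : ℕ) → k ≤ 2 * v →
    HasDoubleSum ℕ.+-0-rawMonoid
    (λ j r → binom (+ j) (+ r)
    * binom (+ v ℤ.- + j) (+ r)
    * binom (+ v ℤ.- + (j + r)) (+ k ℤ.- + (2 * j + r)))
    (f (2 * v) k)
    × HasSum ℚ.+-0-rawMonoid (risingTerm k v) (+ (f (2 * v) k) ℚ./ 1)
theorem2p6 k v k≤2v =
  ( (λ j → ideals j v k)
  -- The inner sum stops after `r = j`, where `j C r` becomes 0; both outer sums stop after `j = v`,
  -- as a word of length `v` has at most `v` twos.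
  , (λ j → suc j , inner-0 j , ∑doubleTerm≡ideals k v j)
  , suc v , (λ j → reindex-v< (words j) k) , sym f≡∑)
  , suc v
  , (λ j v<j → trans (risingTerm≡ideals v j k≤2v)
                   (cong (λ n → + n ℚ./ 1) (reindex-v< (words j) k v<j)))
  , trans (sum-/1 (suc v) (λ j → ideals j v k) (λ j → risingTerm≡ideals v j k≤2v))
          (cong (λ n → + n ℚ./ 1) (sym f≡∑))
  where
  f≡∑ : f (2 * v) k ≡ ∑ (suc v) (λ j → ideals j v k)
  f≡∑ = f≡∑ideals k (n<1+n v)
  inner-0 : ∀ j r → j < r → doubleTerm k v j r ≡ 0
  inner-0 j r j<r = cong
    (λ c → c * binom (+ v ℤ.- + j) (+ r) * binom (+ v ℤ.- + (j + r)) (+ k ℤ.- + (2 * j + r)))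
    (k>n⇒nCk≡0 j<r)
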